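{- Let $\mathcal X=(\Omega,S)$ be a coherent configuration and let $s$ be a relation of $\mathcal X$ which is connected. Suppose that for every point $\alpha\in\Omega$ the coherent configuration $(\mathcal X_\alpha)_{\alpha s}$ is semiregular. Then for every $(\alpha,\beta)\in s$ with $\alpha\ne\beta$ the set $\{\alpha,\beta\}$ is a base of $\mathcal X$. In particular $b(\mathcal X)\le 2$.
   Context: A coherent configuration on a finite set $\Omega$ is a pair $\mathcal X=(\Omega,S)$ where $S$ is a partition of $\Omega\times\Omega$ such that $1_\Omega$ is a union of elements of $S$, $s^*=\{(\beta,\alpha):(\alpha,\beta)\in s\}\in S$ for $s\in S$, and for $r,s,t\in S$ the number $|\{\gamma:(\alpha,\gamma)\in r,(\gamma,\beta)\in s\}|$ is independent of $(\alpha,\beta)\in t$. Relations are unions of elements of $S$; fibers are sets $\Gamma$ with $1_\Gamma\in S$. A relation $s$ is connected if it is symmetric ($s=s^*$) and any two distinct points of $\Omega$ are joined by a path in the graph $(\Omega,s)$. For $\gamma\in\Omega$, $\gamma s=\{\delta:(\gamma,\delta)\in s\}$. A fission of $\mathcal X$ is a coherent configuration on $\Omega$ whose relations include those of $\mathcal X$; complete means every basic relation is a singleton. $\mathcal X_\alpha$ is the smallest fission of $\mathcal X$ in which $\{\alpha\}$ is a fiber; $\alpha s$ is a union of fibers of $\mathcal X_\alpha$. For a union $\Gamma$ of fibers the restriction is $\mathcal X_\Gamma=(\Gamma,\{r\cap\Gamma^2:r\in S\}\setminus\{\emptyset\})$. A coherent configuration $(\Gamma,T)$ is semiregular if $|\{\delta:(\gamma,\delta)\in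 t\}|\le 1$ for all $\gamma\in\Gamma$, $t\in T$. A set $B$ is a base of $\mathcal X$ if the smallest fission in which all $\{\beta\}$, $\beta\in B$, are fibers is complete; $b(\mathcal X)$ is the minimal size of a base. -}

module Defs where

open import Data.Bool using (_∧_; if_then_else_)
open import Data.Fin using (Fin)
open import Data.Fin.Subset using (Subset; _∈_; _⊆_; _∩_; ⊥; ⁅_⁆; ∣_∣)
open import Data.List using (List)
open import Data.List.Relation.Unary.All using (All)
open import Data.List.Relation.Unary.Any using (Any)
open import Data.Nat using (ℕ; _≤_)
open import Data.Product using (∃; ∃₂; ∃!; _×_; _,_)
open import Data.Vec using (Vec; lookup; tabulate)
open import Function using (_⇔_)
open import Level using (0ℓ)
open import Relation.Binary.Construct.Closure.ReflexiveTransitive using (Star)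
open import Relation.Binary.PropositionalEquality using (_≡_; _≢_)
open import Relation.Unary using (Pred)

private
  variable
    n : ℕ

-- A binary relation on Fin n is a Boolean matrix, so that two relations with
-- the same pairs are propositionally equal.  Row α is the set αr.
Rel : ℕ → Set
Rel n = Vec (Subset n) n

infix 8 _▷_
_▷_ : Fin n → Rel n → Subset n
α ▷ r = lookup r α

infix 4 _⟨_⟩_
_⟨_⟩_ : Fin n → Rel n → Fin n → Set
α ⟨ r ⟩ β = β ∈ α ▷ r

infix 9 _*
_* : Rel n → Rel n
r * = tabulate λ β → tabulate λ α → lookup (α ▷ r) β

diagonal : Subset n → Rel n
diagonal Γ = tabulate λ α → ⁅ α ⁆ ∩ Γ

-- r ∩ Γ²
_↾_ : Rel n → Subset n → Rel n
r ↾ Γ = tabulate λ α → if lookup Γ α then α ▷ r ∩ Γ else ⊥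

NonEmpty : Rel n → Set
NonEmpty r = ∃₂ λ α β → α ⟨ r ⟩ β

-- { γ : (α,γ) ∈ r, (γ,β) ∈ s }
between : Rel n → Rel n → Fin n → Fin n → Subset n
between r s α β = tabulate λ γ → lookup (α ▷ r) γ ∧ lookup (γ ▷ s) β

-- Finite lists suffice as subfamilies of S, since Rel n is finite.
IsUnionOf : Pred (Rel n) 0ℓ → Rel n → Set
IsUnionOf {n} S r = ∃ λ (U : List (Rel n)) →
  All S U × (∀ α β → α ⟨ r ⟩ β ⇔ Any (λ u → α ⟨ u ⟩ β) U)

record IsPartition (Ω : Subset n) (S : Pred (Rel n) 0ℓ) : Set where
  field
    nonEmpty : ∀ {r} → S r → NonEmpty r
    within   : ∀ {r α β} → S r → α ⟨ r ⟩ β → α ∈ Ω × β ∈ Ω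
    covers   : ∀ {α β} → α ∈ Ω → β ∈ Ω → ∃ λ r → S r × α ⟨ r ⟩ β
    disjoint : ∀ {r s α β} → S r → S s → α ⟨ r ⟩ β → α ⟨ s ⟩ β → r ≡ s

-- The point set is a subset Ω of some Fin n, so that configurations on
-- different subsets of the same ambient set live side by side.
record CoherentConfiguration (Ω : Subset n) : Set₁ where
  field
    Basic        : Pred (Rel n) 0ℓ
    isPartition  : IsPartition Ω Basic
    diagonal-∪   : IsUnionOf Basic (diagonal Ω)
    *-closed     : ∀ {s} → Basic s → Basic (s *)
    intersection : ∀ {r s t} → Basic r → Basic s → Basic t →
                   ∀ {α β α′ β′} → α ⟨ t ⟩ β → α′ ⟨ t ⟩ β′ →
                   ∣ between r s α β ∣ ≡ ∣ between r s α′ β′ ∣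

open CoherentConfiguration public using (Basic)

module _ {n : ℕ} {Ω : Subset n} where

  IsRelation : CoherentConfiguration Ω → Rel n → Set
  IsRelation X = IsUnionOf (Basic X)

  IsFiber : CoherentConfiguration Ω → Subset n → Set
  IsFiber X Γ = Basic X (diagonal Γ)

  -- Y is a fission of X
  IsFission : (X Y : CoherentConfiguration Ω) → Set
  IsFission X Y = ∀ r → IsRelation X r → IsRelation Y r

  Complete : CoherentConfiguration Ω → Set
  Complete X = ∀ s → Basic X s → ∃! _≡_ λ ((α , β) : Fin n × Fin n) → α ⟨ s ⟩ β

  IsFissionFixing : CoherentConfiguration Ω → Subset n → CoherentConfiguration Ω → Set
  IsFissionFixing X B Y = IsFission X Y × (∀ β → β ∈ B → IsFiber Y ⁅ β ⁆)

  -- Y is the smallest fission of X in which all {β}, β ∈ B, are fibers; it is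
  -- determined up to logical equivalence of the predicate Basic Y.
  IsExtension : CoherentConfiguration Ω → Subset n → CoherentConfiguration Ω → Set₁
  IsExtension X B Y =
    IsFissionFixing X B Y × (∀ Z → IsFissionFixing X B Z → IsFission Y Z)

  IsBase : CoherentConfiguration Ω → Subset n → Set₁
  IsBase X B = B ⊆ Ω × (∃ λ Y → IsExtension X B Y × Complete Y)

  -- b(X) = b
  IsBaseNumber : CoherentConfiguration Ω → ℕ → Set₁
  IsBaseNumber X b =
    (∃ λ B → IsBase X B × ∣ B ∣ ≡ b) × (∀ B → IsBase X B → b ≤ ∣ B ∣)

  -- The set of basic relations of the restriction of X to Γ.
  RestrictedBasic : CoherentConfiguration Ω → Subset n → Pred (Rel n) 0ℓ
  RestrictedBasic X Γ t = (∃ λ r → Basic X r × t ≡ r ↾ Γ) × NonEmpty t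

Connected : Subset n → Rel n → Set
Connected Ω s =
  s ≡ s * ×
  (∀ α β → α ∈ Ω → β ∈ Ω → α ≢ β → Star (λ γ δ → γ ⟨ s ⟩ δ) α β)

-- Semiregularity of the pair (Γ, T); it does not refer to the coherence of
-- (Γ, T), which holds whenever T = RestrictedBasic X Γ with Γ a union of fibers.
Semiregular : Subset n → Pred (Rel n) 0ℓ → Set
Semiregular Γ T = ∀ γ t → γ ∈ Γ → T t → ∣ γ ▷ t ∣ ≤ 1

{-# OPTIONS --safe #-}
module Submission where

-- Let Y be a fission of X in which {α} and {β} are fibers, (α,β) ∈ s.  Then Y is
-- also a fission of X_α.  A point γ of αs is the only point of αs joined to β by
-- the basic relation of X_α through (β,γ), by semiregularity; so {γ} is a fiber
-- of Y too.  Since s is symmetric, (γ,α) is again an edge with both ends fixed,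
-- and connectedness spreads this to all of Ω, which makes Y complete.
--
-- The smallest fission fixing B is obtained by Weisfeiler–Leman refinement: start
-- from the basic relations of X, split at the points of B, and keep separating
-- pairs with different intersection numbers.  Every coherent fission fixing B
-- stays finer than the current partition throughout, so the stable partition is
-- the smallest.  Being computed, it also makes IsBase decidable, whence the
-- minimum in the base number.

open import Defs
open import Data.Bool using (Bool; if_then_else_; true; _∧_)
open import Data.Bool.Properties using (∧-conicalˡ; ∧-conicalʳ) renaming (_≟_ to _≟ᵇ_)
open import Data.Fin using (Fin; combine; remQuot)
open import Data.Fin.Properties using (any?; all?; remQuot-combine; _≟_)
open import Data.Fin.Subset using (Subset; _∈_; _∉_; _⊆_; _∪_; _∩_; ⁅_⁆; ∣_∣; inside; outside; Nonempty) renaming (⊥ to ∅)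
open import Data.Fin.Subset.Properties
open import Data.List using (List; []; _∷_; foldr; map; filter; allFin; cartesianProduct)
open import Data.List.Membership.Propositional using (find; lose) renaming (_∈_ to _∈ˡ_)
open import Data.List.Membership.Propositional.Properties using (∈-filter⁺; ∈-filter⁻; ∈-cartesianProduct⁺; ∈-allFin)
open import Data.List.Relation.Unary.All using (All; []; _∷_; tabulate; lookup)
open import Data.List.Relation.Unary.All.Properties using () renaming (map⁺ to All-map⁺)
open import Data.List.Relation.Unary.Any using (Any; here; there) renaming (any? to Any?; map to Any-map)
open import Data.List.Relation.Unary.Any.Properties using () renaming (map⁺ to Any-map⁺; map⁻ to Any-map⁻)
open import Data.Nat using (ℕ; _+_; _*_; _≤_; _<_; z≤n; s≤s)
open import Data.Nat.Induction using (Acc; acc; <-wellFounded)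
open import Data.Nat.Properties using (+-suc; ≤-trans; ≤-reflexive; <⇒≱; ≮⇒≥; <⇒≤; _<?_; +-monoʳ-≤; module ≤-Reasoning) renaming (_≟_ to _≟ⁿ_)
open import Data.Product using (∃; ∃₂; _×_; _,_; proj₁; proj₂; swap; uncurry)
open import Data.Product.Properties using () renaming (≡-dec to ×-≡-dec)
open import Data.Sum using (_⊎_; inj₁; inj₂; [_,_]′)
open import Data.Vec using ([]; _∷_; zipWith; replicate)
open import Data.Vec.Properties using (lookup∘tabulate; tabulate∘lookup; tabulate-cong; lookup⇒[]=; []=⇒lookup; lookup-zipWith; lookup-replicate; ≡-dec)
open import Function using (id; mk⇔; _∘_; Equivalence)
open import Level using (Level)
open import Relation.Binary.Construct.Closure.ReflexiveTransitive using (Star; ε; _◅_)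
open import Relation.Binary.PropositionalEquality using (_≡_; _≢_; refl; sym; trans; cong; cong₂; subst; module ≡-Reasoning)
open import Relation.Nullary using (Dec; yes; no; ¬_; does; contradiction; map′; _×-dec_; ¬?)
open import Relation.Nullary.Decidable using (dec-true; decidable-stable; _→-dec_)
open import Relation.Unary using (Pred)

import Data.Product as Product
import Data.Sum as Sum
import Data.Vec as Vec

private
  variable
    n : ℕ
    ℓ : Level

-- Subsets

∣p∪q∣≡∣p∣+∣q∣ : (p q : Subset n) → (∀ {x} → x ∈ p → x ∉ q) → ∣ p ∪ q ∣ ≡ ∣ p ∣ + ∣ q ∣
∣p∪q∣≡∣p∣+∣q∣ []            []            dis = refl
∣p∪q∣≡∣p∣+∣q∣ (inside ∷ p)  (inside ∷ q)  dis = contradiction Vec.here (dis Vec.here)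
∣p∪q∣≡∣p∣+∣q∣ (inside ∷ p)  (outside ∷ q) dis =
  cong ℕ.suc (∣p∪q∣≡∣p∣+∣q∣ p q λ x∈p x∈q → dis (Vec.there x∈p) (Vec.there x∈q))
∣p∪q∣≡∣p∣+∣q∣ (outside ∷ p) (inside ∷ q)  dis = trans
  (cong ℕ.suc (∣p∪q∣≡∣p∣+∣q∣ p q λ x∈p x∈q → dis (Vec.there x∈p) (Vec.there x∈q)))
  (sym (+-suc ∣ p ∣ ∣ q ∣))
∣p∪q∣≡∣p∣+∣q∣ (outside ∷ p) (outside ∷ q) dis =
  ∣p∪q∣≡∣p∣+∣q∣ p q λ x∈p x∈q → dis (Vec.there x∈p) (Vec.there x∈q)

∣p∪q∣≤∣p∣+∣q∣ : (p q : Subset n) → ∣ p ∪ q ∣ ≤ ∣ p ∣ + ∣ q ∣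
∣p∪q∣≤∣p∣+∣q∣ []            []            = z≤n
∣p∪q∣≤∣p∣+∣q∣ (inside ∷ p)  (y ∷ q)       =
  s≤s (≤-trans (∣p∪q∣≤∣p∣+∣q∣ p q) (+-monoʳ-≤ ∣ p ∣ (∣p∣≤∣x∷p∣ y q)))
∣p∪q∣≤∣p∣+∣q∣ (outside ∷ p) (inside ∷ q)  =
  ≤-trans (s≤s (∣p∪q∣≤∣p∣+∣q∣ p q)) (≤-reflexive (sym (+-suc ∣ p ∣ ∣ q ∣)))
∣p∪q∣≤∣p∣+∣q∣ (outside ∷ p) (outside ∷ q) = ∣p∪q∣≤∣p∣+∣q∣ p q

x∈p⇒0<∣p∣ : ∀ {x} {p : Subset n} → x ∈ p → 0 < ∣ p ∣
x∈p⇒0<∣p∣ x∈p = ≤-trans (s≤s z≤n) (x∈p⇒∣p-x∣<∣p∣ x∈p)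

0<∣p∣⇒Nonempty : (p : Subset n) → 0 < ∣ p ∣ → Nonempty p
0<∣p∣⇒Nonempty (inside ∷ p)  _  = Fin.zero , Vec.here
0<∣p∣⇒Nonempty (outside ∷ p) 0< with 0<∣p∣⇒Nonempty p 0<
... | x , x∈p = Fin.suc x , Vec.there x∈p

∣p∣≤1⇒unique : ∀ {x y} {p : Subset n} → ∣ p ∣ ≤ 1 → x ∈ p → y ∈ p → x ≡ y
∣p∣≤1⇒unique {x = x} {y} ∣p∣≤1 x∈p y∈p with x ≟ y
... | yes x≡y = x≡y
... | no  x≢y = contradiction ∣p∣≤1
  (<⇒≱ (≤-trans (s≤s (x∈p⇒0<∣p∣ (x∈p∧x≢y⇒x∈p-y x∈p x≢y))) (x∈p⇒∣p-x∣<∣p∣ y∈p)))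

∈-tabulate⁺ : (f : Fin n → Bool) → ∀ {x} → f x ≡ true → x ∈ Vec.tabulate f
∈-tabulate⁺ f {x} eq = lookup⇒[]= x _ (trans (lookup∘tabulate f x) eq)

∈-tabulate⁻ : (f : Fin n → Bool) → ∀ {x} → x ∈ Vec.tabulate f → f x ≡ true
∈-tabulate⁻ f {x} x∈ = trans (sym (lookup∘tabulate f x)) ([]=⇒lookup x∈)

does⇒ : {A : Set ℓ} (a? : Dec A) → does a? ≡ true → A
does⇒ (yes a) _ = a

⟦_⟧ : {P : Pred (Fin n) ℓ} → (∀ x → Dec (P x)) → Subset n
⟦ P? ⟧ = Vec.tabulate (does ∘ P?)

∈⟦⟧⁺ : {P : Pred (Fin n) ℓ} (P? : ∀ x → Dec (P x)) → ∀ {x} → P x → x ∈ ⟦ P? ⟧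
∈⟦⟧⁺ P? {x} px = ∈-tabulate⁺ (does ∘ P?) (dec-true (P? x) px)

∈⟦⟧⁻ : {P : Pred (Fin n) ℓ} (P? : ∀ x → Dec (P x)) → ∀ {x} → x ∈ ⟦ P? ⟧ → P x
∈⟦⟧⁻ P? {x} x∈ = does⇒ (P? x) (∈-tabulate⁻ (does ∘ P?) x∈)

-- As long as `F p` misses a point of `p`, it has fewer elements, so the iteration stops by
-- well-founded induction on size. `P` is an invariant carried along to the fixpoint.
deflationary-fixpoint : (F : Subset n → Subset n) → (∀ p → F p ⊆ p) →
  (P : Pred (Subset n) ℓ) → (∀ {p} → P p → P (F p)) →
  ∀ p → P p → ∃ λ q → P q × q ⊆ F q
deflationary-fixpoint F F⊆ P step p = go p (<-wellFounded ∣ p ∣)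
  where
  go : ∀ p → Acc _<_ ∣ p ∣ → P p → ∃ λ q → P q × q ⊆ F q
  go p (acc rs) Pp with any? (λ x → (x ∈? p) ×-dec ¬? (x ∈? F p))
  ... | yes (x , x∈p , x∉Fp) = go (F p) (rs (p⊂q⇒∣p∣<∣q∣ (F⊆ p , x , x∈p , x∉Fp))) (step Pp)
  ... | no  none = p , Pp , λ {x} x∈p → decidable-stable (x ∈? F p) λ x∉ → none (x , x∈p , x∉)

-- Binary relations as Boolean matrices

Pair : ℕ → Set
Pair n = Fin n × Fin n

infix 4 _∈ʳ_ _∈ʳ?_ _≟ʳ_
_∈ʳ_ : Pair n → Rel n → Set
(α , β) ∈ʳ r = α ⟨ r ⟩ β

_∈ʳ?_ : (p : Pair n) (r : Rel n) → Dec (p ∈ʳ r)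
(α , β) ∈ʳ? r = β ∈? (α ▷ r)

_≟ʳ_ : (r s : Rel n) → Dec (r ≡ s)
_≟ʳ_ = ≡-dec (≡-dec _≟ᵇ_)

allPairs : ∀ n → List (Pair n)
allPairs n = cartesianProduct (allFin n) (allFin n)

∈-allPairs : (p : Pair n) → p ∈ˡ allPairs n
∈-allPairs (α , β) = ∈-cartesianProduct⁺ (∈-allFin α) (∈-allFin β)

∀-pair? : {P : Pred (Pair n) ℓ} → (∀ p → Dec (P p)) → Dec (∀ p → P p)
∀-pair? P? = map′ (λ f (α , β) → f α β) (λ f α β → f (α , β))
  (all? λ α → all? λ β → P? (α , β))

rel-ext : {r s : Rel n} → (∀ p → p ∈ʳ r → p ∈ʳ s) → (∀ p → p ∈ʳ s → p ∈ʳ r) → r ≡ s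
rel-ext {r = r} {s} r⊆s s⊆r = begin
  r                            ≡⟨ tabulate∘lookup r ⟨
  Vec.tabulate (Vec.lookup r)  ≡⟨ tabulate-cong (λ α → ⊆-antisym (λ {β} → r⊆s (α , β)) (λ {β} → s⊆r (α , β))) ⟩
  Vec.tabulate (Vec.lookup s)  ≡⟨ tabulate∘lookup s ⟩
  s                            ∎
  where open ≡-Reasoning

⟦_⟧ʳ : {P : Pred (Pair n) ℓ} → (∀ p → Dec (P p)) → Rel n
⟦ P? ⟧ʳ = Vec.tabulate λ α → ⟦ (λ β → P? (α , β)) ⟧

∈⟦⟧ʳ⁺ : {P : Pred (Pair n) ℓ} (P? : ∀ p → Dec (P p)) → ∀ p → P p → p ∈ʳ ⟦ P? ⟧ʳ
∈⟦⟧ʳ⁺ P? (α , β) Pp =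
  subst (β ∈_) (sym (lookup∘tabulate _ α)) (∈⟦⟧⁺ (λ β → P? (α , β)) Pp)

∈⟦⟧ʳ⁻ : {P : Pred (Pair n) ℓ} (P? : ∀ p → Dec (P p)) → ∀ p → p ∈ʳ ⟦ P? ⟧ʳ → P p
∈⟦⟧ʳ⁻ P? (α , β) p∈ =
  ∈⟦⟧⁻ (λ β → P? (α , β)) (subst (β ∈_) (lookup∘tabulate _ α) p∈)

*⁺ : (r : Rel n) → ∀ p → p ∈ʳ r → swap p ∈ʳ r *
*⁺ r (α , β) p∈ = subst (α ∈_) (sym (lookup∘tabulate _ β)) (∈-tabulate⁺ _ ([]=⇒lookup p∈))

*⁻ : (r : Rel n) → ∀ p → p ∈ʳ r * → swap p ∈ʳ r
*⁻ r (α , β) p∈ = lookup⇒[]= α _ (∈-tabulate⁻ _ (subst (β ∈_) (lookup∘tabulate _ α) p∈))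

diagonal⁺ : (Γ : Subset n) → ∀ {α} → α ∈ Γ → α ⟨ diagonal Γ ⟩ α
diagonal⁺ Γ {α} α∈ = subst (α ∈_) (sym (lookup∘tabulate _ α)) (x∈p∩q⁺ (x∈⁅x⁆ α , α∈))

diagonal⁻ : (Γ : Subset n) → ∀ α β → α ⟨ diagonal Γ ⟩ β → α ≡ β × α ∈ Γ
diagonal⁻ Γ α β p∈ with x∈p∩q⁻ ⁅ α ⁆ Γ (subst (β ∈_) (lookup∘tabulate _ α) p∈)
... | β∈ , β∈Γ with refl ← x∈⁅y⁆⇒x≡y α β∈ = refl , β∈Γ

between⁺ : (r s : Rel n) → ∀ α β γ → α ⟨ r ⟩ γ → γ ⟨ s ⟩ β → γ ∈ between r s α β
between⁺ r s α β γ αγ γβ = ∈-tabulate⁺ _ (cong₂ _∧_ ([]=⇒lookup αγ) ([]=⇒lookup γβ))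

between⁻ : (r s : Rel n) → ∀ α β γ → γ ∈ between r s α β → α ⟨ r ⟩ γ × γ ⟨ s ⟩ β
between⁻ r s α β γ γ∈ =
  lookup⇒[]= γ _ (∧-conicalˡ _ _ eq) , lookup⇒[]= β _ (∧-conicalʳ (Vec.lookup (α ▷ r) γ) _ eq)
  where eq = ∈-tabulate⁻ _ γ∈

↾⁺ : (r : Rel n) (Γ : Subset n) → ∀ {α β} → α ∈ Γ → β ∈ Γ → α ⟨ r ⟩ β → α ⟨ r ↾ Γ ⟩ β
↾⁺ r Γ {α} α∈ β∈ αβ
  rewrite lookup∘tabulate (λ α → if Vec.lookup Γ α then α ▷ r ∩ Γ else ∅) α | []=⇒lookup α∈ =
  x∈p∩q⁺ (αβ , β∈)

-- Unions of relations and additivity of the counts of intermediate points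

infixr 6 _∪ʳ_
_∪ʳ_ : Rel n → Rel n → Rel n
_∪ʳ_ = zipWith _∪_

∅ʳ : Rel n
∅ʳ = replicate _ ∅

∪ʳ⁺ˡ : (r s : Rel n) → ∀ p → p ∈ʳ r → p ∈ʳ r ∪ʳ s
∪ʳ⁺ˡ r s (α , β) p∈ = subst (β ∈_) (sym (lookup-zipWith _∪_ α r s)) (x∈p∪q⁺ (inj₁ p∈))

∪ʳ⁺ʳ : (r s : Rel n) → ∀ p → p ∈ʳ s → p ∈ʳ r ∪ʳ s
∪ʳ⁺ʳ r s (α , β) p∈ = subst (β ∈_) (sym (lookup-zipWith _∪_ α r s)) (x∈p∪q⁺ (inj₂ p∈))

∪ʳ⁻ : (r s : Rel n) → ∀ p → p ∈ʳ r ∪ʳ s → p ∈ʳ r ⊎ p ∈ʳ s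
∪ʳ⁻ r s (α , β) p∈ = x∈p∪q⁻ _ _ (subst (β ∈_) (lookup-zipWith _∪_ α r s) p∈)

∉∅ʳ : (p : Pair n) → ¬ p ∈ʳ ∅ʳ
∉∅ʳ (α , β) p∈ = ∉⊥ (subst (β ∈_) (lookup-replicate α ∅) p∈)

⋃ʳ : List (Rel n) → Rel n
⋃ʳ = foldr _∪ʳ_ ∅ʳ

⋃ʳ⁺ : (U : List (Rel n)) → ∀ p → Any (p ∈ʳ_) U → p ∈ʳ ⋃ʳ U
⋃ʳ⁺ (u ∷ U) p (here p∈)  = ∪ʳ⁺ˡ u (⋃ʳ U) p p∈
⋃ʳ⁺ (u ∷ U) p (there p∈) = ∪ʳ⁺ʳ u (⋃ʳ U) p (⋃ʳ⁺ U p p∈)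

⋃ʳ⁻ : (U : List (Rel n)) → ∀ p → p ∈ʳ ⋃ʳ U → Any (p ∈ʳ_) U
⋃ʳ⁻ []      p p∈ = contradiction p∈ (∉∅ʳ p)
⋃ʳ⁻ (u ∷ U) p p∈ = [ here , there ∘ ⋃ʳ⁻ U p ]′ (∪ʳ⁻ u (⋃ʳ U) p p∈)

Disjoint : Rel n → Rel n → Set
Disjoint r s = ∀ p → p ∈ʳ r → ¬ p ∈ʳ s

∣between∣ : Rel n → Rel n → Pair n → ℕ
∣between∣ r s (α , β) = ∣ between r s α β ∣

∣between∣-∅ˡ : (s : Rel n) → ∀ p → ∣between∣ ∅ʳ s p ≡ 0
∣between∣-∅ˡ {n} s (α , β) = trans (cong ∣_∣ (Empty-unique λ (γ , γ∈) →
  ∉∅ʳ (α , γ) (proj₁ (between⁻ ∅ʳ s α β γ γ∈)))) (∣⊥∣≡0 n)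

∣between∣-∅ʳ : (r : Rel n) → ∀ p → ∣between∣ r ∅ʳ p ≡ 0
∣between∣-∅ʳ {n} r (α , β) = trans (cong ∣_∣ (Empty-unique λ (γ , γ∈) →
  ∉∅ʳ (γ , β) (proj₂ (between⁻ r ∅ʳ α β γ γ∈)))) (∣⊥∣≡0 n)

-- Disjointness splits the intermediate points into two disjoint sets, so the counts add. With its
-- mirror image below, this carries intersection numbers from basic relations to their unions.
∣between∣-∪ˡ : (r r′ s : Rel n) → Disjoint r r′ → ∀ p →
  ∣between∣ (r ∪ʳ r′) s p ≡ ∣between∣ r s p + ∣between∣ r′ s p
∣between∣-∪ˡ r r′ s dis (α , β) = trans
  (cong ∣_∣ (⊆-antisym
    (λ {γ} γ∈ → let αγ , γβ = between⁻ (r ∪ʳ r′) s α β γ γ∈ in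
      x∈p∪q⁺ (Sum.map (λ m → between⁺ r s α β γ m γβ) (λ m → between⁺ r′ s α β γ m γβ)
        (∪ʳ⁻ r r′ (α , γ) αγ)))
    (λ {γ} γ∈ → [ (λ m → let αγ , γβ = between⁻ r s α β γ m in
                    between⁺ (r ∪ʳ r′) s α β γ (∪ʳ⁺ˡ r r′ (α , γ) αγ) γβ)
                , (λ m → let αγ , γβ = between⁻ r′ s α β γ m in
                    between⁺ (r ∪ʳ r′) s α β γ (∪ʳ⁺ʳ r r′ (α , γ) αγ) γβ) ]′
                (x∈p∪q⁻ _ _ γ∈))))
  (∣p∪q∣≡∣p∣+∣q∣ _ _ λ {γ} m m′ → dis (α , γ)
    (proj₁ (between⁻ r s α β γ m)) (proj₁ (between⁻ r′ s α β γ m′)))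

∣between∣-∪ʳ : (r s s′ : Rel n) → Disjoint s s′ → ∀ p →
  ∣between∣ r (s ∪ʳ s′) p ≡ ∣between∣ r s p + ∣between∣ r s′ p
∣between∣-∪ʳ r s s′ dis (α , β) = trans
  (cong ∣_∣ (⊆-antisym
    (λ {γ} γ∈ → let αγ , γβ = between⁻ r (s ∪ʳ s′) α β γ γ∈ in
      x∈p∪q⁺ (Sum.map (between⁺ r s α β γ αγ) (between⁺ r s′ α β γ αγ)
        (∪ʳ⁻ s s′ (γ , β) γβ)))
    (λ {γ} γ∈ → [ (λ m → let αγ , γβ = between⁻ r s α β γ m in
                    between⁺ r (s ∪ʳ s′) α β γ αγ (∪ʳ⁺ˡ s s′ (γ , β) γβ))
                , (λ m → let αγ , γβ = between⁻ r s′ α β γ m in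
                    between⁺ r (s ∪ʳ s′) α β γ αγ (∪ʳ⁺ʳ s s′ (γ , β) γβ)) ]′
                (x∈p∪q⁻ _ _ γ∈))))
  (∣p∪q∣≡∣p∣+∣q∣ _ _ λ {γ} m m′ → dis (γ , β)
    (proj₂ (between⁻ r s α β γ m)) (proj₂ (between⁻ r s′ α β γ m′)))

-- Coherent configurations

infix 4 _∼[_]_
-- The partition into basic relations, seen as a partial equivalence that is reflexive exactly on
-- the pairs from Ω × Ω. Fibers, fissions and completeness are all handled through it.
record _∼[_]_ {n : ℕ} {Ω : Subset n} (p : Pair n) (X : CoherentConfiguration Ω) (q : Pair n) : Set where
  constructor same
  field
    {rel} : Rel n
    basic : Basic X rel
    left  : p ∈ʳ rel
    right : q ∈ʳ rel

Invariant : {Ω : Subset n} → CoherentConfiguration Ω → Rel n → Set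
Invariant X r = ∀ {p q} → p ∼[ X ] q → p ∈ʳ r → q ∈ʳ r

Within : Subset n → Rel n → Set
Within Ω r = ∀ α β → α ⟨ r ⟩ β → α ∈ Ω × β ∈ Ω

Discrete : {Ω : Subset n} → CoherentConfiguration Ω → Set
Discrete X = ∀ {p q} → p ∼[ X ] q → p ≡ q

-- The fiber of γ is {γ}.
Isolated : {Ω : Subset n} → CoherentConfiguration Ω → Fin n → Set
Isolated X γ = ∀ {δ ε ζ} → (γ , ε) ∼[ X ] (δ , ζ) → γ ≡ δ

module Configuration {n : ℕ} {Ω : Subset n} (X : CoherentConfiguration Ω) where
  open CoherentConfiguration X hiding (Basic)
  open IsPartition isPartition

  infix 4 _∼_ _∼?_
  _∼_ : Pair n → Pair n → Set
  p ∼ q = p ∼[ X ] q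

  ∼-refl : ∀ {α β} → α ∈ Ω → β ∈ Ω → (α , β) ∼ (α , β)
  ∼-refl α∈ β∈ with _ , Br , p∈ ← covers α∈ β∈ = same Br p∈ p∈

  ∼-sym : ∀ {p q} → p ∼ q → q ∼ p
  ∼-sym (same Br p∈ q∈) = same Br q∈ p∈

  ∼-basic : ∀ {p q r} → p ∼ q → Basic X r → p ∈ʳ r → q ∈ʳ r
  ∼-basic {α , β} {q} (same Bs p∈s q∈s) Br p∈r =
    subst (q ∈ʳ_) (disjoint {α = α} {β} Bs Br p∈s p∈r) q∈s

  ∼-trans : ∀ {p q o} → p ∼ q → q ∼ o → p ∼ o
  ∼-trans p∼q (same Br q∈ o∈) = same Br (∼-basic (∼-sym p∼q) Br q∈) o∈

  ∼-within : ∀ {α β q} → (α , β) ∼ q → α ∈ Ω × β ∈ Ω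
  ∼-within {α} {β} (same Br p∈ _) = within {α = α} {β} Br p∈

  ∼-swap : ∀ {p q} → p ∼ q → swap p ∼ swap q
  ∼-swap {p} {q} (same {r} Br p∈ q∈) = same (*-closed Br) (*⁺ r p p∈) (*⁺ r q q∈)

  -- `Basic X` is an arbitrary predicate, but `covers` supplies the basic relation through the first
  -- pair, and membership of the second pair in that matrix is decidable.
  _∼?_ : ∀ p q → Dec (p ∼ q)
  (α , β) ∼? q with (α ∈? Ω) ×-dec (β ∈? Ω)
  ... | no  p∉ = no (p∉ ∘ ∼-within)
  ... | yes (α∈ , β∈) with r , Br , p∈ ← covers α∈ β∈ =
    map′ (same Br p∈) (λ p∼q → ∼-basic p∼q Br p∈) (q ∈ʳ? r)

  -- The point `γ` shows that an intersection number is positive at (α,β); coherence makes it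
  -- positive at (α′,β′) as well, which yields `γ′`.
  triangle : ∀ {α β α′ β′ γ} → (α , β) ∼ (α′ , β′) → γ ∈ Ω →
    ∃ λ γ′ → (α , γ) ∼ (α′ , γ′) × (γ , β) ∼ (γ′ , β′)
  triangle {α} {β} {α′} {β′} {γ} p∼q@(same Bt p∈ q∈) γ∈
    with r , Br , αγ ← covers (proj₁ (∼-within p∼q)) γ∈
       | s , Bs , γβ ← covers γ∈ (proj₂ (∼-within p∼q))
    with γ′ , γ′∈ ← 0<∣p∣⇒Nonempty (between r s α′ β′)
      (subst (0 <_) (intersection Br Bs Bt {α} {β} {α′} {β′} p∈ q∈)
        (x∈p⇒0<∣p∣ (between⁺ r s α β γ αγ γβ)))
    with α′γ′ , γ′β′ ← between⁻ r s α′ β′ γ′ γ′∈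
    = γ′ , same Br αγ α′γ′ , same Bs γβ γ′β′

  class : Pair n → Rel n
  class p = ⟦ p ∼?_ ⟧ʳ

  class-basic : ∀ {α β} → α ∈ Ω → β ∈ Ω → Basic X (class (α , β))
  class-basic {α} {β} α∈ β∈ with r , Br , p∈ ← covers α∈ β∈ =
    subst (Basic X) (rel-ext
      (λ q q∈ → ∈⟦⟧ʳ⁺ ((α , β) ∼?_) q (same Br p∈ q∈))
      (λ q q∈ → ∼-basic (∈⟦⟧ʳ⁻ ((α , β) ∼?_) q q∈) Br p∈)) Br

  basic⇒relation : ∀ r → Basic X r → IsRelation X r
  basic⇒relation r Br = r ∷ [] , Br ∷ [] , λ α β → mk⇔ here λ { (here p∈) → p∈ ; (there ()) }

  relation⇒invariant : ∀ r → IsRelation X r → Invariant X r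
  relation⇒invariant r (U , BU , iff) {α , β} {α′ , β′} p∼q p∈
    with u , u∈ , p∈u ← find (Equivalence.to (iff α β) p∈) =
    Equivalence.from (iff α′ β′) (lose u∈ (∼-basic p∼q (lookup BU u∈) p∈u))

  relation⇒within : ∀ r → IsRelation X r → Within Ω r
  relation⇒within r (U , BU , iff) α β p∈
    with u , u∈ , p∈u ← find (Equivalence.to (iff α β) p∈) = within {α = α} {β} (lookup BU u∈) p∈u

  -- The classes of all pairs in `r` form the required finite list. With `relation⇒invariant`, the
  -- relations of `X` are thus precisely the subsets of Ω × Ω closed under `∼`.
  invariant⇒relation : ∀ r → Within Ω r → Invariant X r → IsRelation X r
  invariant⇒relation r r⊆Ω inv = map class pairs , basics , λ α β → mk⇔ (to α β) (from α β)
    where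
    pairs = filter (_∈ʳ? r) (allPairs n)

    basics : All (Basic X) (map class pairs)
    basics = All-map⁺ (tabulate λ {(α , β)} p∈ →
      uncurry class-basic (r⊆Ω α β (proj₂ (∈-filter⁻ (_∈ʳ? r) {xs = allPairs n} p∈))))

    to : ∀ α β → α ⟨ r ⟩ β → Any ((α , β) ∈ʳ_) (map class pairs)
    to α β p∈ = Any-map⁺ (lose (∈-filter⁺ (_∈ʳ? r) (∈-allPairs (α , β)) p∈)
      (∈⟦⟧ʳ⁺ ((α , β) ∼?_) (α , β) (uncurry ∼-refl (r⊆Ω α β p∈))))

    from : ∀ α β → Any ((α , β) ∈ʳ_) (map class pairs) → α ⟨ r ⟩ β
    from α β any with p , p∈ , q∈ ← find (Any-map⁻ any) =
      inv (∈⟦⟧ʳ⁻ (p ∼?_) (α , β) q∈) (proj₂ (∈-filter⁻ (_∈ʳ? r) {xs = allPairs n} p∈))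

  -- The list behind a union may contain repetitions. Dropping them leaves each basic relation
  -- disjoint from the union of the later ones, as additivity of counts demands.
  relation-induction : (P : Pred (Rel n) ℓ) → P ∅ʳ →
    (∀ {u r} → Basic X u → Disjoint u r → P r → P (u ∪ʳ r)) →
    ∀ r → IsRelation X r → P r
  relation-induction P P∅ P∪ r (U , BU , iff) = subst P
    (rel-ext (λ (α , β) → Equivalence.from (iff α β) ∘ ⋃ʳ⁻ U (α , β))
             (λ (α , β) → ⋃ʳ⁺ U (α , β) ∘ Equivalence.to (iff α β)))
    (go U BU)
    where
    go : ∀ U → All (Basic X) U → P (⋃ʳ U)
    go []      []        = P∅
    go (u ∷ U) (Bu ∷ BU) with Any? (u ≟ʳ_) U
    ... | yes u∈U = subst P (rel-ext
            (λ p → ∪ʳ⁺ʳ u (⋃ʳ U) p)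
            (λ p → [ (λ p∈u → ⋃ʳ⁺ U p (Any-map (λ { refl → p∈u }) u∈U)) , id ]′ ∘ ∪ʳ⁻ u (⋃ʳ U) p))
            (go U BU)
    ... | no  u∉U = P∪ Bu disj (go U BU)
      where
      disj : Disjoint u (⋃ʳ U)
      disj (α , β) p∈u p∈U with v , v∈ , p∈v ← find (⋃ʳ⁻ U (α , β) p∈U) =
        u∉U (lose v∈ (disjoint {α = α} {β} Bu (lookup BU v∈) p∈u p∈v))

  -- Additivity reduces first `r`, then `s`, to basic relations, where `intersection` applies. The
  -- general form serves the refinement below: a block of an intermediate partition may be a union
  -- of several basic relations of a fission.
  ∣between∣-invariant : ∀ r s → IsRelation X r → IsRelation X s →
    ∀ {p q} → p ∼ q → ∣between∣ r s p ≡ ∣between∣ r s q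
  ∣between∣-invariant r s Rr Rs {p} {q} p∼q@(same Bt p∈ q∈) = relation-induction
    (λ r → ∣between∣ r s p ≡ ∣between∣ r s q)
    (trans (∣between∣-∅ˡ s p) (sym (∣between∣-∅ˡ s q)))
    (λ {u} {r} Bu dis eq → begin
      ∣between∣ (u ∪ʳ r) s p               ≡⟨ ∣between∣-∪ˡ u r s dis p ⟩
      ∣between∣ u s p + ∣between∣ r s p     ≡⟨ cong₂ _+_ (basic-left Bu) eq ⟩
      ∣between∣ u s q + ∣between∣ r s q     ≡⟨ ∣between∣-∪ˡ u r s dis q ⟨
      ∣between∣ (u ∪ʳ r) s q               ∎)
    r Rr
    where
    open ≡-Reasoning

    basic-both : ∀ {u v} → Basic X u → Basic X v → ∣between∣ u v p ≡ ∣between∣ u v q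
    basic-both Bu Bv = intersection Bu Bv Bt {proj₁ p} {proj₂ p} {proj₁ q} {proj₂ q} p∈ q∈

    basic-left : ∀ {u} → Basic X u → ∣between∣ u s p ≡ ∣between∣ u s q
    basic-left {u} Bu = relation-induction
      (λ s → ∣between∣ u s p ≡ ∣between∣ u s q)
      (trans (∣between∣-∅ʳ u p) (sym (∣between∣-∅ʳ u q)))
      (λ {v} {s} Bv dis eq → begin
        ∣between∣ u (v ∪ʳ s) p               ≡⟨ ∣between∣-∪ʳ u v s dis p ⟩
        ∣between∣ u v p + ∣between∣ u s p     ≡⟨ cong₂ _+_ (basic-both Bu Bv) eq ⟩
        ∣between∣ u v q + ∣between∣ u s q     ≡⟨ ∣between∣-∪ʳ u v s dis q ⟨
        ∣between∣ u (v ∪ʳ s) q               ∎)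
      s Rs

  ∼-diagonal : ∀ {α β γ} → (α , α) ∼ (β , γ) → β ≡ γ
  ∼-diagonal {α} {β} {γ} p∼q = proj₁ (diagonal⁻ Ω β γ
    (relation⇒invariant (diagonal Ω) diagonal-∪ p∼q (diagonal⁺ Ω (proj₁ (∼-within p∼q)))))

  fiber⇒isolated : ∀ {γ} → IsFiber X ⁅ γ ⁆ → Isolated X γ
  fiber⇒isolated {γ} fib {δ} p∼q
    -- Taking `γ` itself as the intermediate point replaces the pair (γ,ε) by (γ,γ), which lies in
    -- the given basic relation.
    with γ′ , γγ∼δγ′ , _ ← triangle p∼q (proj₁ (∼-within p∼q)) =
    sym (x∈⁅y⁆⇒x≡y γ (proj₂ (diagonal⁻ ⁅ γ ⁆ δ γ′
      (∼-basic γγ∼δγ′ fib (diagonal⁺ ⁅ γ ⁆ (x∈⁅x⁆ γ))))))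

  isolated⇒fiber : ∀ {γ} → γ ∈ Ω → Isolated X γ → IsFiber X ⁅ γ ⁆
  isolated⇒fiber {γ} γ∈ iso = subst (Basic X) (rel-ext to from) (class-basic γ∈ γ∈)
    where
    to : ∀ p → p ∈ʳ class (γ , γ) → p ∈ʳ diagonal ⁅ γ ⁆
    to p p∈ with γγ∼p ← ∈⟦⟧ʳ⁻ ((γ , γ) ∼?_) p p∈
      with refl ← iso γγ∼p with refl ← ∼-diagonal γγ∼p = diagonal⁺ ⁅ γ ⁆ (x∈⁅x⁆ γ)

    from : ∀ p → p ∈ʳ diagonal ⁅ γ ⁆ → p ∈ʳ class (γ , γ)
    from (α , β) p∈ with refl , α∈ ← diagonal⁻ ⁅ γ ⁆ α β p∈
      with refl ← x∈⁅y⁆⇒x≡y γ α∈ = ∈⟦⟧ʳ⁺ ((γ , γ) ∼?_) (γ , γ) (∼-refl γ∈ γ∈)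

  isolated⇒discrete : (∀ {γ} → γ ∈ Ω → Isolated X γ) → Discrete X
  isolated⇒discrete iso p∼q = cong₂ _,_
    (iso (proj₁ (∼-within p∼q)) p∼q) (iso (proj₂ (∼-within p∼q)) (∼-swap p∼q))

  discrete⇒complete : Discrete X → Complete X
  discrete⇒complete disc s Bs with α , β , p∈ ← nonEmpty Bs =
    (α , β) , p∈ , λ {q} q∈ → disc (same Bs p∈ q∈)

  complete⇒discrete : Complete X → Discrete X
  complete⇒discrete comp (same {r} Br p∈ q∈) with _ , _ , unique ← comp r Br =
    trans (sym (unique p∈)) (unique q∈)

  discrete? : Dec (Discrete X)
  discrete? = map′ (λ f {p} {q} → f p q) (λ f p q → f)
    (∀-pair? λ p → ∀-pair? λ q → (p ∼? q) →-dec (×-≡-dec _≟_ _≟_ p q))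

module _ {n : ℕ} {Ω : Subset n} {X Y : CoherentConfiguration Ω} where
  private
    module X = Configuration X
    module Y = Configuration Y

  -- A basic relation of `X` is a relation of `Y`, hence closed under the equivalence of `Y`.
  -- Together with `finer⇒fission`, this lets fissions be treated as refinements of `∼`.
  fission⇒finer : IsFission X Y → ∀ {p q} → p ∼[ Y ] q → p ∼[ X ] q
  fission⇒finer fis p∼q with same {r} Br p∈ _ ← uncurry X.∼-refl (Y.∼-within p∼q) =
    same Br p∈ (Y.relation⇒invariant r (fis r (X.basic⇒relation r Br)) p∼q p∈)

  finer⇒fission : (∀ {p q} → p ∼[ Y ] q → p ∼[ X ] q) → IsFission X Y
  finer⇒fission finer r Rr = Y.invariant⇒relation r (X.relation⇒within r Rr)
    (X.relation⇒invariant r Rr ∘ finer)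


-- The coherent closure

module WeisfeilerLeman {n : ℕ} {Ω : Subset n} (X : CoherentConfiguration Ω)
                       (B : Subset n) (B⊆Ω : B ⊆ Ω) where
  private
    module X = Configuration X

  -- A binary relation on pairs, encoded as a subset so that its size can serve
  -- as a termination measure.
  State : Set
  State = Subset ((n * n) * (n * n))

  index : Pair n → Pair n → Fin ((n * n) * (n * n))
  index (α , β) (γ , δ) = combine (combine α β) (combine γ δ)

  unindex : Fin ((n * n) * (n * n)) → Pair n × Pair n
  unindex i = Product.map (remQuot n) (remQuot n) (remQuot {n * n} (n * n) i)

  unindex-index : ∀ p q → unindex (index p q) ≡ (p , q)
  unindex-index (α , β) (γ , δ) = trans
    (cong (Product.map (remQuot n) (remQuot n)) (remQuot-combine (combine α β) (combine γ δ)))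
    (cong₂ _,_ (remQuot-combine α β) (remQuot-combine γ δ))

  infix 4 _≈[_]_
  record _≈[_]_ (p : Pair n) (E : State) (q : Pair n) : Set where
    constructor related
    field member : index p q ∈ E

  open _≈[_]_

  ≈? : ∀ E p q → Dec (p ≈[ E ] q)
  ≈? E p q = map′ related member (index p q ∈? E)

  ⟪_⟫ : {R : Pair n → Pair n → Set} → (∀ p q → Dec (R p q)) → State
  ⟪ R? ⟫ = ⟦ uncurry R? ∘ unindex ⟧

  ∈⟪⟫⁺ : ∀ {R : Pair n → Pair n → Set} (R? : ∀ p q → Dec (R p q)) {p q} → R p q → index p q ∈ ⟪ R? ⟫
  ∈⟪⟫⁺ {R} R? {p} {q} Rpq =
    ∈⟦⟧⁺ (uncurry R? ∘ unindex) (subst (uncurry R) (sym (unindex-index p q)) Rpq)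

  ∈⟪⟫⁻ : ∀ {R : Pair n → Pair n → Set} (R? : ∀ p q → Dec (R p q)) {p q} → index p q ∈ ⟪ R? ⟫ → R p q
  ∈⟪⟫⁻ {R} R? {p} {q} i∈ =
    subst (uncurry R) (unindex-index p q) (∈⟦⟧⁻ (uncurry R? ∘ unindex) i∈)

  block : State → Pair n → Rel n
  block E u = ⟦ ≈? E u ⟧ʳ

  -- The equation says that p₁ = q₁ as soon as p₁ or q₁ lies in B.
  Initial : Pair n → Pair n → Set
  Initial p q = p ∼[ X ] q × ⁅ proj₁ p ⁆ ∩ B ≡ ⁅ proj₁ q ⁆ ∩ B

  Initial? : ∀ p q → Dec (Initial p q)
  Initial? p q = (p X.∼? q) ×-dec ≡-dec _≟ᵇ_ _ _

  -- The two conditions mirror `*-closed` and `intersection`: they hold for all related pairs once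
  -- the partition is stable. The diagonal axiom is inherited from the starting partition.
  Balanced : State → Pair n → Pair n → Set
  Balanced E p q = swap p ≈[ E ] swap q ×
    (∀ u v → ∣between∣ (block E u) (block E v) p ≡ ∣between∣ (block E u) (block E v) q)

  Balanced? : ∀ E p q → Dec (Balanced E p q)
  Balanced? E p q = ≈? E (swap p) (swap q) ×-dec (∀-pair? λ u → ∀-pair? λ v → _ ≟ⁿ _)

  refine : State → State
  refine E = ⟪ Balanced? E ⟫ ∩ E

  refine⁺ : ∀ {E p q} → Balanced E p q → p ≈[ E ] q → p ≈[ refine E ] q
  refine⁺ {E} bal (related i∈) = related (x∈p∩q⁺ (∈⟪⟫⁺ (Balanced? E) bal , i∈))

  refine⁻ : ∀ {E p q} → p ≈[ refine E ] q → Balanced E p q × p ≈[ E ] q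
  refine⁻ {E} (related i∈) with i∈₁ , i∈₂ ← x∈p∩q⁻ ⟪ Balanced? E ⟫ E i∈ =
    ∈⟪⟫⁻ (Balanced? E) i∈₁ , related i∈₂

  -- The invariant of the refinement. `finer` will make the stable partition a fission of `X` in
  -- which the points of `B` are fixed; `coarser` will make it the smallest one.
  record Admissible (E : State) : Set₁ where
    field
      ≈-refl  : ∀ {α β} → α ∈ Ω → β ∈ Ω → (α , β) ≈[ E ] (α , β)
      ≈-sym   : ∀ {p q} → p ≈[ E ] q → q ≈[ E ] p
      ≈-trans : ∀ {p q o} → p ≈[ E ] q → q ≈[ E ] o → p ≈[ E ] o
      finer   : ∀ {p q} → p ≈[ E ] q → Initial p q
      coarser : ∀ {Z} → IsFissionFixing X B Z → ∀ {p q} → p ∼[ Z ] q → p ≈[ E ] q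

    ≈-within : ∀ {α β q} → (α , β) ≈[ E ] q → α ∈ Ω × β ∈ Ω
    ≈-within p≈q = X.∼-within (proj₁ (finer p≈q))

    block-within : ∀ u → Within Ω (block E u)
    block-within u α β p∈ = ≈-within (≈-sym (∈⟦⟧ʳ⁻ (≈? E u) (α , β) p∈))

    block-relation : ∀ {Z} → IsFissionFixing X B Z → ∀ u → IsRelation Z (block E u)
    block-relation {Z} fix u = Configuration.invariant⇒relation Z (block E u) (block-within u)
      λ {p} {q} p∼q p∈ → ∈⟦⟧ʳ⁺ (≈? E u) q (≈-trans (∈⟦⟧ʳ⁻ (≈? E u) p p∈) (coarser {Z} fix p∼q))

  initial-admissible : Admissible ⟪ Initial? ⟫
  initial-admissible = record
    { ≈-refl  = λ α∈ β∈ → to (X.∼-refl α∈ β∈ , refl)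
    ; ≈-sym   = λ p≈q → let p∼q , eq = from p≈q in to (X.∼-sym p∼q , sym eq)
    ; ≈-trans = λ p≈q q≈o → let p∼q , eq = from p≈q ; q∼o , eq′ = from q≈o in
                  to (X.∼-trans p∼q q∼o , trans eq eq′)
    ; finer   = from
    ; coarser = λ {Z} (fis , fix) p∼q → to (fission⇒finer {X = X} {Z} fis p∼q ,
        ⊆-antisym (fixed Z fix p∼q) (fixed Z fix (Configuration.∼-sym Z p∼q)))
    }
    where
    to : ∀ {p q} → Initial p q → p ≈[ ⟪ Initial? ⟫ ] q
    to ini = related (∈⟪⟫⁺ Initial? ini)

    from : ∀ {p q} → p ≈[ ⟪ Initial? ⟫ ] q → Initial p q
    from (related i∈) = ∈⟪⟫⁻ Initial? i∈

    fixed : ∀ Z → (∀ β → β ∈ B → IsFiber Z ⁅ β ⁆) → ∀ {p q} → p ∼[ Z ] q →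
      ⁅ proj₁ p ⁆ ∩ B ⊆ ⁅ proj₁ q ⁆ ∩ B
    fixed Z fix {α , β} p∼q {x} x∈ with x∈₁ , x∈B ← x∈p∩q⁻ ⁅ α ⁆ B x∈
      with refl ← x∈⁅y⁆⇒x≡y α x∈₁
      with refl ← Configuration.fiber⇒isolated Z (fix x x∈B) p∼q = x∈

  -- The crux is `coarser`: the blocks of `E` are relations of `Z`, so their counts are constant on
  -- each class of `Z`. A refinement step thus never separates pairs that `Z` leaves together.
  refine-admissible : ∀ {E} → Admissible E → Admissible (refine E)
  refine-admissible {E} adm = record
    { ≈-refl  = λ α∈ β∈ → refine⁺ (≈-refl β∈ α∈ , λ _ _ → refl) (≈-refl α∈ β∈)
    ; ≈-sym   = λ p≈q → let (sw , eq) , r = refine⁻ p≈q in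
                  refine⁺ (≈-sym sw , λ u v → sym (eq u v)) (≈-sym r)
    ; ≈-trans = λ p≈q q≈o → let (sw , eq) , r = refine⁻ p≈q ; (sw′ , eq′) , r′ = refine⁻ q≈o in
                  refine⁺ (≈-trans sw sw′ , λ u v → trans (eq u v) (eq′ u v)) (≈-trans r r′)
    ; finer   = finer ∘ proj₂ ∘ refine⁻
    ; coarser = λ {Z} fix p∼q → refine⁺
        (coarser {Z} fix (Configuration.∼-swap Z p∼q) ,
         λ u v → Configuration.∣between∣-invariant Z (block E u) (block E v)
                   (block-relation {Z} fix u) (block-relation {Z} fix v) p∼q)
        (coarser {Z} fix p∼q)
    }
    where open Admissible adm

  module Stable {E : State} (adm : Admissible E) (stable : E ⊆ refine E) where
    open Admissible adm

    balanced : ∀ {p q} → p ≈[ E ] q → Balanced E p q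
    balanced (related i∈) = proj₁ (refine⁻ (related (stable i∈)))

    block⁺ : ∀ {u} p → u ≈[ E ] p → p ∈ʳ block E u
    block⁺ {u} = ∈⟦⟧ʳ⁺ (≈? E u)

    block⁻ : ∀ {u} p → p ∈ʳ block E u → u ≈[ E ] p
    block⁻ {u} = ∈⟦⟧ʳ⁻ (≈? E u)

    block-cong : ∀ {u v} → u ≈[ E ] v → block E u ≡ block E v
    block-cong u≈v = rel-ext
      (λ p p∈ → block⁺ p (≈-trans (≈-sym u≈v) (block⁻ p p∈)))
      (λ p p∈ → block⁺ p (≈-trans u≈v (block⁻ p p∈)))

    block-* : ∀ u → block E u * ≡ block E (swap u)
    block-* u = rel-ext
      (λ p p∈ → block⁺ {swap u} p (proj₁ (balanced (block⁻ {u} (swap p) (*⁻ (block E u) p p∈)))))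
      (λ p p∈ → *⁺ (block E u) (swap p) (block⁺ {u} (swap p) (proj₁ (balanced (block⁻ {swap u} p p∈)))))

    -- Representatives are taken from Ω × Ω, since the block of any other pair is empty.
    IsBlock : Pred (Rel n) _
    IsBlock r = ∃₂ λ α β → α ∈ Ω × β ∈ Ω × r ≡ block E (α , β)

    -- The block of (γ,γ) stays on the diagonal because the partition refines that of `X`, where the
    -- diagonal is already a relation.
    diagonal-union : IsUnionOf IsBlock (diagonal Ω)
    diagonal-union = map (λ α → block E (α , α)) points , blocks , λ α β → mk⇔ (to α β) (from α β)
      where
      points = filter (_∈? Ω) (allFin n)

      in-Ω : ∀ {α} → α ∈ˡ points → α ∈ Ω
      in-Ω α∈ = proj₂ (∈-filter⁻ (_∈? Ω) {xs = allFin n} α∈)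

      blocks : All IsBlock (map (λ α → block E (α , α)) points)
      blocks = All-map⁺ (tabulate λ {α} α∈ → α , α , in-Ω α∈ , in-Ω α∈ , refl)

      to : ∀ α β → α ⟨ diagonal Ω ⟩ β → Any ((α , β) ∈ʳ_) (map (λ α → block E (α , α)) points)
      to α β p∈ with refl , α∈ ← diagonal⁻ Ω α β p∈ =
        Any-map⁺ (lose (∈-filter⁺ (_∈? Ω) (∈-allFin α) α∈) (block⁺ (α , α) (≈-refl α∈ α∈)))

      from : ∀ α β → Any ((α , β) ∈ʳ_) (map (λ α → block E (α , α)) points) → α ⟨ diagonal Ω ⟩ β
      from α β any with γ , _ , p∈ ← find (Any-map⁻ any)
        with γγ∼αβ ← proj₁ (finer (block⁻ (α , β) p∈))
        with refl ← X.∼-diagonal γγ∼αβ = diagonal⁺ Ω (proj₁ (X.∼-within (X.∼-sym γγ∼αβ)))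

    closure : CoherentConfiguration Ω
    closure = record
      { Basic        = IsBlock
      ; isPartition  = record
        { nonEmpty = λ { (α , β , α∈ , β∈ , refl) → α , β , block⁺ (α , β) (≈-refl α∈ β∈) }
        ; within   = λ { {_} {α} {β} (γ , δ , _ , _ , refl) p∈ → block-within (γ , δ) α β p∈ }
        ; covers   = λ {α} {β} α∈ β∈ →
            block E (α , β) , (α , β , α∈ , β∈ , refl) , block⁺ (α , β) (≈-refl α∈ β∈)
        ; disjoint = λ { {_} {_} {α} {β} (_ , _ , _ , _ , refl) (_ , _ , _ , _ , refl) p∈r p∈s →
            block-cong (≈-trans (block⁻ (α , β) p∈r) (≈-sym (block⁻ (α , β) p∈s))) }
        }
      ; diagonal-∪   = diagonal-union
      ; *-closed     = λ { (α , β , α∈ , β∈ , refl) → β , α , β∈ , α∈ , block-* (α , β) }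
      ; intersection = λ { (α₁ , β₁ , _ , _ , refl) (α₂ , β₂ , _ , _ , refl) (_ , _ , _ , _ , refl)
            {α} {β} {α′} {β′} p∈ q∈ →
            proj₂ (balanced (≈-trans (≈-sym (block⁻ (α , β) p∈)) (block⁻ (α′ , β′) q∈)))
              (α₁ , β₁) (α₂ , β₂) }
      }

    ∼⇒≈ : ∀ {p q} → p ∼[ closure ] q → p ≈[ E ] q
    ∼⇒≈ {p} {q} (same (_ , _ , _ , _ , refl) p∈ q∈) = ≈-trans (≈-sym (block⁻ p p∈)) (block⁻ q q∈)

    ≈⇒∼ : ∀ {p q} → p ≈[ E ] q → p ∼[ closure ] q
    ≈⇒∼ {p} {q} p≈q with α∈ , β∈ ← ≈-within p≈q =
      same (_ , _ , α∈ , β∈ , refl) (block⁺ p (≈-refl α∈ β∈)) (block⁺ q p≈q)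

    base-isolated : ∀ {β} → β ∈ B → Isolated closure β
    base-isolated {β} β∈ {δ} p∼q = x∈⁅y⁆⇒x≡y δ (proj₁ (x∈p∩q⁻ ⁅ δ ⁆ B
      (subst (β ∈_) (proj₂ (finer (∼⇒≈ p∼q))) (x∈p∩q⁺ (x∈⁅x⁆ β , β∈)))))

    closure-extension : IsExtension X B closure
    closure-extension =
      ( finer⇒fission {X = X} {closure} (proj₁ ∘ finer ∘ ∼⇒≈)
      , λ β β∈ → Configuration.isolated⇒fiber closure (B⊆Ω β∈) (base-isolated β∈)) ,
      λ Z fix → finer⇒fission {X = closure} {Z} (≈⇒∼ ∘ coarser {Z} fix)

  -- Kept opaque: later arguments use only the specification `IsExtension`, never how the partition
  -- was computed.
  abstract
    extension : ∃ (IsExtension X B)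
    extension with _ , adm , stable ← deflationary-fixpoint refine (λ E → p∩q⊆q ⟪ Balanced? E ⟫ E)
                     Admissible refine-admissible ⟪ Initial? ⟫ initial-admissible
      = Stable.closure adm stable , Stable.closure-extension adm stable

-- Bases and the propagation of fixed points

module Bases {n : ℕ} {Ω : Subset n} (X : CoherentConfiguration Ω) where
  open WeisfeilerLeman X using (extension)

  extension-discrete⇒base : ∀ {B} (B⊆Ω : B ⊆ Ω) → Discrete (proj₁ (extension B B⊆Ω)) → IsBase X B
  extension-discrete⇒base {B} B⊆Ω disc with Y , ext ← extension B B⊆Ω =
    B⊆Ω , Y , ext , Configuration.discrete⇒complete Y disc

  -- A base comes with some smallest fission `Z` that is complete. By minimality of `Z` the computed
  -- extension is a fission of it, hence also discrete, so testing the computed one decides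
  -- `IsBase`.
  base⇒extension-discrete : ∀ {B} (B⊆Ω : B ⊆ Ω) → IsBase X B → Discrete (proj₁ (extension B B⊆Ω))
  base⇒extension-discrete {B} B⊆Ω (_ , Z , (_ , Z-least) , comp) with Y , fix , _ ← extension B B⊆Ω =
    Configuration.complete⇒discrete Z comp ∘ fission⇒finer {X = Z} {Y} (Z-least Y fix)

  base? : ∀ B → Dec (IsBase X B)
  base? B with B ⊆? Ω
  ... | no  B⊈Ω = no (B⊈Ω ∘ proj₁)
  ... | yes B⊆Ω = map′ (extension-discrete⇒base B⊆Ω) (base⇒extension-discrete B⊆Ω)
                    (Configuration.discrete? (proj₁ (extension B B⊆Ω)))

  -- Descent on size: since `IsBase` is decidable, a smaller base can be searched for among all
  -- subsets, and when none exists the minimum is reached.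
  baseNumber-≤ : ∀ {B k} → IsBase X B → ∣ B ∣ ≤ k → ∃ λ b → IsBaseNumber X b × b ≤ k
  baseNumber-≤ {B} {k} = go B (<-wellFounded ∣ B ∣)
    where
    go : ∀ B → Acc _<_ ∣ B ∣ → IsBase X B → ∣ B ∣ ≤ k → ∃ λ b → IsBaseNumber X b × b ≤ k
    go B (acc rs) base ∣B∣≤k with anySubset? (λ B′ → base? B′ ×-dec (∣ B′ ∣ <? ∣ B ∣))
    ... | yes (B′ , base′ , lt) = go B′ (rs lt) base′ (≤-trans (<⇒≤ lt) ∣B∣≤k)
    ... | no  none =
      ∣ B ∣ , ((B , base , refl) , λ B′ base′ → ≮⇒≥ λ lt → none (B′ , base′ , lt)) , ∣B∣≤k

module Propagation {n : ℕ} {Ω : Subset n} (X : CoherentConfiguration Ω) (s : Rel n)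
  (Rs : IsRelation X s) (conn : Connected Ω s)
  (semiregular : ∀ α → α ∈ Ω → (Xα : CoherentConfiguration Ω) → IsExtension X ⁅ α ⁆ Xα →
    Semiregular (α ▷ s) (RestrictedBasic Xα (α ▷ s))) where

  s-within : Within Ω s
  s-within = Configuration.relation⇒within X s Rs

  s-sym : ∀ α β → α ⟨ s ⟩ β → β ⟨ s ⟩ α
  s-sym α β αβ = *⁻ s (α , β) (subst (λ r → α ⟨ r ⟩ β) (proj₁ conn) αβ)

  module _ {Y : CoherentConfiguration Ω} (fis : IsFission X Y) where
    open Configuration Y

    -- Inside αs, the basic relation of X_α through (β , γ) has at most one pair
    -- starting at β, so any point in the Y-fiber of γ is γ itself.
    spread : ∀ {α β γ} → α ⟨ s ⟩ β → α ⟨ s ⟩ γ → Isolated Y α → Isolated Y β → Isolated Y γ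
    spread {α} {β} {γ} αβ αγ iso-α iso-β {δ} p∼q
      with α∈ , β∈ ← s-within α β αβ
      -- With `α` and `β` as intermediate points, the hypothesis gives (γ,α) ∼ (δ,α′) and (γ,β) ∼
      -- (δ,β′); isolation then forces α′ = α and β′ = β.
      with α′ , γα∼δα′ , _ ← triangle p∼q α∈ | β′ , γβ∼δβ′ , _ ← triangle p∼q β∈
      with refl ← iso-α (∼-swap γα∼δα′) | refl ← iso-β (∼-swap γβ∼δβ′)
      with Xα , ext ← WeisfeilerLeman.extension X ⁅ α ⁆
             (λ x∈ → subst (_∈ Ω) (sym (x∈⁅y⁆⇒x≡y α x∈)) α∈)
      -- `Y` fixes `α`, so by minimality it is a fission of `Xα`, and one basic relation `t` of `Xα`
      -- contains both (β,γ) and (β,δ).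
      with same {t} Bt βγ βδ ← fission⇒finer {X = Xα} {Y}
             (proj₂ ext Y (fis , λ x x∈ →
               subst (IsFiber Y ∘ ⁅_⁆) (sym (x∈⁅y⁆⇒x≡y α x∈)) (isolated⇒fiber α∈ iso-α)))
             (∼-swap γβ∼δβ′)
      = ∣p∣≤1⇒unique
          (semiregular α α∈ Xα ext β (t ↾ (α ▷ s)) αβ ((t , Bt , refl) , β , γ , βγ↾))
          βγ↾ (↾⁺ t (α ▷ s) αβ αδ βδ)
      where
      -- Since `s` is a relation of `Y`, the point `δ` lies in αs along with `γ`, so both pairs
      -- survive the restriction to αs.
      αδ = relation⇒invariant s (fis s Rs) (∼-swap γα∼δα′) αγ
      βγ↾ = ↾⁺ t (α ▷ s) αβ αγ βγ

    isolated-path : ∀ {α β γ} → α ⟨ s ⟩ β → Isolated Y α → Isolated Y β →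
      Star (λ γ δ → γ ⟨ s ⟩ δ) α γ → Isolated Y γ
    isolated-path αβ iso-α iso-β ε = iso-α
    isolated-path {α} αβ iso-α iso-β (_◅_ {j = δ} αδ path) =
      -- The path continues from the edge (δ,α): `spread` has just isolated `δ`, and symmetry of `s`
      -- turns the edge around.
      isolated-path (s-sym α δ αδ) (spread αβ αδ iso-α iso-β) iso-α path

    edge⇒discrete : ∀ {α β} → α ⟨ s ⟩ β → Isolated Y α → Isolated Y β → Discrete Y
    edge⇒discrete {α} {β} αβ iso-α iso-β = isolated⇒discrete isolated
      where
      isolated : ∀ {γ} → γ ∈ Ω → Isolated Y γ
      isolated {γ} γ∈ with α ≟ γ
      ... | yes refl = iso-α
      ... | no  α≢γ  = isolated-path αβ iso-α iso-β (proj₂ conn α γ (proj₁ (s-within α β αβ)) γ∈ α≢γ)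

  open Bases X

  edge⇒base : ∀ α β → α ⟨ s ⟩ β → IsBase X (⁅ α ⁆ ∪ ⁅ β ⁆)
  edge⇒base α β αβ = B⊆Ω , Y , ext , Configuration.discrete⇒complete Y
    (edge⇒discrete {Y} (proj₁ (proj₁ ext)) αβ
      (iso (x∈p∪q⁺ (inj₁ (x∈⁅x⁆ α)))) (iso (x∈p∪q⁺ (inj₂ (x∈⁅x⁆ β)))))
    where
    αβ∈ = s-within α β αβ

    B⊆Ω : ⁅ α ⁆ ∪ ⁅ β ⁆ ⊆ Ω
    B⊆Ω x∈ = [ (λ m → subst (_∈ Ω) (sym (x∈⁅y⁆⇒x≡y α m)) (proj₁ αβ∈))
             , (λ m → subst (_∈ Ω) (sym (x∈⁅y⁆⇒x≡y β m)) (proj₂ αβ∈)) ]′ (x∈p∪q⁻ _ _ x∈)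

    Y = proj₁ (WeisfeilerLeman.extension X (⁅ α ⁆ ∪ ⁅ β ⁆) B⊆Ω)
    ext = proj₂ (WeisfeilerLeman.extension X (⁅ α ⁆ ∪ ⁅ β ⁆) B⊆Ω)

    iso : ∀ {γ} → γ ∈ ⁅ α ⁆ ∪ ⁅ β ⁆ → Isolated Y γ
    iso {γ} γ∈ = Configuration.fiber⇒isolated Y (proj₂ (proj₁ ext) γ γ∈)

  -- A connected relation without edges leaves at most one point in Ω, so every point is isolated
  -- before any is fixed.
  no-edge⇒∅-base : (∀ α β → ¬ α ⟨ s ⟩ β) → IsBase X ∅
  no-edge⇒∅-base no-edge = extension-discrete⇒base {∅} ⊥⊆
    (Configuration.isolated⇒discrete Y λ γ∈ p∼q →
      all-equal γ∈ (proj₁ (Configuration.∼-within Y (Configuration.∼-sym Y p∼q))))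
    where
    Y = proj₁ (WeisfeilerLeman.extension X ∅ ⊥⊆)

    all-equal : ∀ {α β} → α ∈ Ω → β ∈ Ω → α ≡ β
    all-equal {α} {β} α∈ β∈ with α ≟ β
    ... | yes α≡β = α≡β
    ... | no  α≢β with proj₂ conn α β α∈ β∈ α≢β
    ...   | ε = refl
    ...   | _◅_ {j = γ} αγ _ = contradiction αγ (no-edge α γ)

  baseNumber-≤2 : ∃ λ b → IsBaseNumber X b × b ≤ 2
  baseNumber-≤2 with any? (λ α → any? λ β → (α , β) ∈ʳ? s)
  ... | yes (α , β , αβ) = baseNumber-≤ (edge⇒base α β αβ) (begin
    -- An inequality, since the edge found may be a loop.
    ∣ ⁅ α ⁆ ∪ ⁅ β ⁆ ∣      ≤⟨ ∣p∪q∣≤∣p∣+∣q∣ ⁅ α ⁆ ⁅ β ⁆ ⟩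
    ∣ ⁅ α ⁆ ∣ + ∣ ⁅ β ⁆ ∣  ≡⟨ cong₂ _+_ (∣⁅x⁆∣≡1 α) (∣⁅x⁆∣≡1 β) ⟩
    2                      ∎)
    where open ≤-Reasoning
  ... | no  none = baseNumber-≤ (no-edge⇒∅-base λ α β αβ → none (α , β , αβ))
    (≤-trans (≤-reflexive (∣⊥∣≡0 n)) z≤n)

theorem3p3 : ∀ {n} (Ω : Subset n) (X : CoherentConfiguration Ω) (s : Rel n) →
    IsRelation X s →
    Connected Ω s →
    (∀ α → α ∈ Ω → (Xα : CoherentConfiguration Ω) → IsExtension X ⁅ α ⁆ Xα →
    Semiregular (α ▷ s) (RestrictedBasic Xα (α ▷ s))) →
    (∀ α β → α ⟨ s ⟩ β → α ≢ β → IsBase X (⁅ α ⁆ ∪ ⁅ β ⁆)) ×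
    (∃ λ b → IsBaseNumber X b × b ≤ 2)
theorem3p3 Ω X s Rs conn semiregular =
  (λ α β αβ _ → edge⇒base α β αβ) , baseNumber-≤2
  where open Propagation X s Rs conn semiregular
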